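{- Let $\mathcal F'$ be a finite set of structures in $Rel^{cov}(\Delta,\Delta')$. Suppose there exists a finite set of structures $\mathcal D'$ such that $(\mathcal F',\mathcal D')$ is a finite duality in $Rel^{cov}(\Delta,\Delta')$. Then $\Phi(\mathrm{Forb}(\mathcal F'))=\{\Phi(\mathbf A'):\mathbf A'\in\mathrm{Forb}(\mathcal F')\}$ coincides with $CSP(\Phi(\mathcal D'))=\bigcup_{\mathbf D'\in\mathcal D'}CSP(\Phi(\mathbf D'))$. Explicitly: for every $\mathbf A\in Rel(\Delta)$ there exists $\mathbf A'\in Rel(\Delta,\Delta')$ with $\Phi(\mathbf A')=\mathbf A$ and $\mathbf F'\not\to\mathbf A'$ for every $\mathbf F'\in\mathcal F'$ if and only if $\mathbf A\to\Phi(\mathbf D')$ for some $\mathbf D'\in\mathcal D'$.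
   Context: For a finite relational signature $\Delta$, $Rel(\Delta)$ is the class of finite relational structures of signature $\Delta$ with homomorphisms (maps preserving all relations); $\mathbf A\to\mathbf B$ means there is a homomorphism. For disjoint signatures $\Delta,\Delta'$, $Rel(\Delta,\Delta')=Rel(\Delta\cup\Delta')$, and $\Phi:Rel(\Delta,\Delta')\to Rel(\Delta)$ is the forgetful functor deleting the relations of $\Delta'$ (identity on maps). $Rel^{cov}(\Delta,\Delta')$ is the class of structures in $Rel(\Delta,\Delta')$ where all relations in $\Delta'$ have a common arity $r$ and every $r$-tuple of elements belongs to some relation of $\Delta'$, with homomorphisms as morphisms. For a finite set $\mathcal F'$ in a category $\mathcal C$ of structures, $\mathrm{Forb}(\mathcal F')$ is the class of $\mathbf A'\in\mathcal C$ with $\mathbf F'\not\to\mathbf A'$ for all $\mathbf F'\in\mathcal F'$; for a finite set $\mathcal D'$, $CSP(\mathcal D')$ is the class of $\mathbf A'\in\mathcal C$ with $\mathbf A'\to\mathbf D'$ for some $\mathbf D'\in\mathcal D'$. The pair $(\mathcal F',\mathcal D')$ is a finite duality in $\mathcal C$ if $\mathrm{Forb}(\mathcal F')=CSP(\mathcal D')$ in $\mathcal C$. $\Phi(\mathcal D')=\{\Phi(\mathbf D'):\mathbf D'\in\mathcal D'\}$, and $CSP(\Phi(\mathcal D'))$ is taken in $Rel(\Delta)$.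
   Formalization: In the explicit equivalence the lift A′ is required to lie in Rel^cov(Δ,Δ′), not merely in Rel(Δ,Δ′), and the members of D′ are required to lie in Rel^cov(Δ,Δ′); without these requirements the claim fails. -}

module Defs where

open import Data.Bool.Base using (Bool; T)
open import Data.Fin.Base using (Fin)
open import Data.Fin.Properties using (+↔⊎)
open import Data.List.Base using (List)
open import Data.List.Relation.Unary.All using (All)
open import Data.List.Relation.Unary.Any using (Any)
open import Data.Nat.Base using (ℕ; _+_)
open import Data.Product.Base using (Σ-syntax; ∃-syntax; _×_; _,_)
open import Data.Sum.Base using (_⊎_; inj₁; inj₂; [_,_])
open import Data.Sum.Function.Propositional using (_⊎-↔_)
open import Data.Vec.Base using (Vec; map; cast)
open import Function.Bundles using (_↔_)
open import Function.Construct.Composition using (_↔-∘_)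
open import Function.Construct.Symmetry using (↔-sym)
open import Relation.Binary.PropositionalEquality.Core using (_≡_; sym)
open import Relation.Nullary.Negation.Core using (¬_)
open import Relation.Unary using (Pred; _≐_; _∩_)
open import Level using (Level; 0ℓ; suc; _⊔_)

Finite : Set → Set
Finite X = ∃[ n ] (X ↔ Fin n)

record Signature : Set₁ where
  field
    Symbol : Set
    finite : Finite Symbol
    arity  : Symbol → ℕ

open Signature public

-- The union of two disjoint signatures; disjointness is enforced by tagging.
infixr 6 _∪ˢ_
_∪ˢ_ : Signature → Signature → Signature
Symbol (Δ ∪ˢ Δ′) = Symbol Δ ⊎ Symbol Δ′
finite (Δ ∪ˢ Δ′) with finite Δ | finite Δ′
... | m , e | n , e′ = m + n , (↔-sym (+↔⊎ {m} {n}) ↔-∘ (e ⊎-↔ e′))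
arity  (Δ ∪ˢ Δ′) = [ arity Δ , arity Δ′ ]

-- Relations are subsets given by Bool-valued characteristic functions, since
-- membership in a relation of a finite structure is decidable.  Finiteness of
-- the carrier is imposed by the classes Rel and Relᶜᵒᵛ below, so that equality
-- of structures does not compare enumerations of the carriers.
record Structure (Δ : Signature) : Set₁ where
  field
    Carrier : Set
    rel     : (s : Symbol Δ) → Vec Carrier (arity Δ s) → Bool

open Structure public

infix 4 _⟶_
record _⟶_ {Δ : Signature} (A B : Structure Δ) : Set where
  field
    fun       : Carrier A → Carrier B
    preserves : (s : Symbol Δ) (t : Vec (Carrier A) (arity Δ s)) →
                T (rel A s t) → T (rel B s (map fun t))

open _⟶_ public

Φ : {Δ Δ′ : Signature} → Structure (Δ ∪ˢ Δ′) → Structure Δ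
Carrier (Φ A′) = Carrier A′
rel (Φ A′) s   = rel A′ (inj₁ s)

-- The full subcategories considered are given by their classes of objects.
Rel : (Δ : Signature) → Pred (Structure Δ) 0ℓ
Rel Δ A = Finite (Carrier A)

CommonArity : Signature → ℕ → Set
CommonArity Δ r = (s : Symbol Δ) → arity Δ s ≡ r

Covered : (Δ : Signature) {Δ′ : Signature} {r : ℕ} → CommonArity Δ′ r →
          Pred (Structure (Δ ∪ˢ Δ′)) 0ℓ
Covered Δ {Δ′} {r} ar A′ =
  (t : Vec (Carrier A′) r) →
  Σ[ s ∈ Symbol Δ′ ] T (rel A′ (inj₂ s) (cast (sym (ar s)) t))

Relᶜᵒᵛ : (Δ Δ′ : Signature) {r : ℕ} → CommonArity Δ′ r →
         Pred (Structure (Δ ∪ˢ Δ′)) 0ℓ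
Relᶜᵒᵛ Δ Δ′ ar = Rel (Δ ∪ˢ Δ′) ∩ Covered Δ ar

-- Finite sets of structures are lists; order and repetitions play no role.
module _ {Δ : Signature} {ℓ : Level} (𝒞 : Pred (Structure Δ) ℓ) where

  Forb : List (Structure Δ) → Pred (Structure Δ) (suc 0ℓ ⊔ ℓ)
  Forb ℱ A = 𝒞 A × All (λ F → ¬ (F ⟶ A)) ℱ

  CSP : List (Structure Δ) → Pred (Structure Δ) (suc 0ℓ ⊔ ℓ)
  CSP 𝒟 A = 𝒞 A × Any (λ D → A ⟶ D) 𝒟

  record FiniteDuality (ℱ 𝒟 : List (Structure Δ)) : Set (suc 0ℓ ⊔ ℓ) where
    field
      ℱ⊆𝒞      : All 𝒞 ℱ
      𝒟⊆𝒞      : All 𝒞 𝒟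
      Forb≐CSP : Forb ℱ ≐ CSP 𝒟

Φ[_] : {Δ Δ′ : Signature} {ℓ : Level} →
       Pred (Structure (Δ ∪ˢ Δ′)) ℓ → Pred (Structure Δ) (suc 0ℓ ⊔ ℓ)
Φ[_] {Δ} {Δ′} 𝒦 A = Σ[ A′ ∈ Structure (Δ ∪ˢ Δ′) ] (𝒦 A′ × Φ A′ ≡ A)

-- The union of the classes 𝒦 D over the members D of a finite set.
⋃ : {Δ Δ″ : Signature} {ℓ : Level} → List (Structure Δ″) →
    (Structure Δ″ → Pred (Structure Δ) ℓ) → Pred (Structure Δ) (suc 0ℓ ⊔ ℓ)
⋃ 𝒟 𝒦 A = Any (λ D → 𝒦 D A) 𝒟

{-# OPTIONS --safe #-}
module Submission where

-- A colouring of A (an expansion to Δ ∪ Δ′) mapping to D′ gives A ⟶ Φ D′ by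
-- forgetting Δ′.  Conversely, f : A ⟶ Φ D′ pulls the relations of Δ′ back from
-- D′ to A.  The pullback is covered because D′ is, and f is a homomorphism from
-- it to D′, so the duality puts it in Forb ℱ′.

open import Defs
open import Data.List.Base using (List; map; [_])
open import Data.List.Membership.Propositional using (find; lose)
open import Data.List.Relation.Unary.All as All using (All)
open import Data.List.Relation.Unary.Any as Any using (Any)
open import Data.List.Relation.Unary.Any.Properties using (map⁺; map⁻; singleton⁺; singleton⁻)
open import Data.Nat.Base using (ℕ)
open import Data.Product.Base using (Σ-syntax; _×_; _,_; proj₁; proj₂)
open import Data.Sum.Base using (inj₁; inj₂)
import Data.Vec.Base as Vec
open import Data.Vec.Properties using (map-cast)
open import Data.Bool.Base using (T)
open import Function.Base using (id)
open import Function.Bundles using (_⇔_; mk⇔)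
open import Relation.Binary.PropositionalEquality.Core using (_≡_; refl; sym; subst)
open import Relation.Nullary.Negation.Core using (¬_)
open import Relation.Unary using (_≐_)

module _ {Δ Δ′ : Signature} where

  Φ-⟶ : {A′ B′ : Structure (Δ ∪ˢ Δ′)} → A′ ⟶ B′ → Φ A′ ⟶ Φ B′
  Φ-⟶ f .fun         = fun f
  Φ-⟶ f .preserves s = preserves f (inj₁ s)

  module _ {A : Structure Δ} (D′ : Structure (Δ ∪ˢ Δ′)) (f : A ⟶ Φ D′) where

    -- The `Δ`-relations are copied from `A` rather than pulled back along `f`, so that `Φ` returns
    -- `A` definitionally.
    pullback : Structure (Δ ∪ˢ Δ′)
    pullback .Carrier        = Carrier A
    pullback .rel (inj₁ s) t = rel A s t
    pullback .rel (inj₂ s) t = rel D′ (inj₂ s) (Vec.map (fun f) t)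

    pullback-⟶ : pullback ⟶ D′
    pullback-⟶ .fun                = fun f
    pullback-⟶ .preserves (inj₁ s) = preserves f s
    pullback-⟶ .preserves (inj₂ s) = λ _ → id

    pullback-covered : {r : ℕ} (ar : CommonArity Δ′ r) →
                       Covered Δ ar D′ → Covered Δ ar pullback
    pullback-covered ar cov t with cov (Vec.map (fun f) t)
    -- The symbol holding of the image tuple also serves for `t`. `h` speaks of the cast of the
    -- mapped tuple, the goal of the map of the cast tuple.
    ... | s , h = s , subst (λ u → T (rel D′ (inj₂ s) u))
                            (sym (map-cast (fun f) (sym (ar s)) t)) h

  module _ {r : ℕ} (ar : CommonArity Δ′ r) {ℱ′ 𝒟′ : List (Structure (Δ ∪ˢ Δ′))}
           (duality : FiniteDuality (Relᶜᵒᵛ Δ Δ′ ar) ℱ′ 𝒟′) where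

    open FiniteDuality duality

    Φ[Forb]⇒⟶Φ : {A : Structure Δ} → Φ[ Forb (Relᶜᵒᵛ Δ Δ′ ar) ℱ′ ] A →
                 Any (λ D′ → A ⟶ Φ D′) 𝒟′
    Φ[Forb]⇒⟶Φ (A′ , forb , refl) = Any.map Φ-⟶ (proj₂ (proj₁ Forb≐CSP forb))

    ⟶Φ⇒Φ[Forb] : {A : Structure Δ} → Rel Δ A → Any (λ D′ → A ⟶ Φ D′) 𝒟′ →
                 Φ[ Forb (Relᶜᵒᵛ Δ Δ′ ar) ℱ′ ] A
    ⟶Φ⇒Φ[Forb] fin any with find any
    ... | D′ , D′∈𝒟′ , f = 
      -- The duality only speaks of covered structures, so `inCov` must come before it can be
      -- applied.
      pullback D′ f , proj₂ Forb≐CSP (inCov , lose D′∈𝒟′ (pullback-⟶ D′ f)) , refl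
      where
      inCov : Relᶜᵒᵛ Δ Δ′ ar (pullback D′ f)
      -- The carrier is that of `A`, hence finite; `D′` is covered because the duality lies within
      -- the covered class.
      inCov = fin , pullback-covered D′ f ar (proj₂ (All.lookup 𝒟⊆𝒞 D′∈𝒟′))

theorem10 : (Δ Δ′ : Signature) (r : ℕ) (ar : CommonArity Δ′ r)
    (ℱ′ : List (Structure (Δ ∪ˢ Δ′))) → All (Relᶜᵒᵛ Δ Δ′ ar) ℱ′ →
    (𝒟′ : List (Structure (Δ ∪ˢ Δ′))) → FiniteDuality (Relᶜᵒᵛ Δ Δ′ ar) ℱ′ 𝒟′ →
    (Φ[ Forb (Relᶜᵒᵛ Δ Δ′ ar) ℱ′ ] ≐ CSP (Rel Δ) (map Φ 𝒟′))
    × (CSP (Rel Δ) (map Φ 𝒟′) ≐ ⋃ 𝒟′ (λ D′ → CSP (Rel Δ) [ Φ D′ ]))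
    × ((A : Structure Δ) → Rel Δ A →
    (Σ[ A′ ∈ Structure (Δ ∪ˢ Δ′) ]
    (Relᶜᵒᵛ Δ Δ′ ar A′ × Φ A′ ≡ A × All (λ F′ → ¬ (F′ ⟶ A′)) ℱ′))
    ⇔ Any (λ D′ → A ⟶ Φ D′) 𝒟′)
theorem10 Δ Δ′ r ar ℱ′ _ 𝒟′ duality =
    ( (λ { x@(_ , ((fin , _) , _) , refl) → fin , map⁺ (Φ[Forb]⇒⟶Φ ar duality x) })
    , (λ (fin , any) → ⟶Φ⇒Φ[Forb] ar duality fin (map⁻ any)))
  , ( (λ (fin , any) → Any.map (λ f → fin , singleton⁺ f) (map⁻ any))
    -- Each class in the union carries finiteness of `A`, so whichever one contains `A` supplies it.
    , (λ any → proj₁ (proj₂ (Any.satisfied any)) , map⁺ (Any.map (λ (_ , f) → singleton⁻ f) any)))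
  , λ A fin → mk⇔
      (λ (A′ , inCov , eq , forb) → Φ[Forb]⇒⟶Φ ar duality (A′ , (inCov , forb) , eq))
      (λ any → let A′ , (inCov , forb) , eq = ⟶Φ⇒Φ[Forb] ar duality fin any
               in A′ , inCov , eq , forb)
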